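{- Let $K_{m_1,m_2}$ be the complete bipartite graph with bipartition $(X,Y)$, $X=\{x_1,\dots,x_{m_1}\}$, $Y=\{y_1,\dots,y_{m_2}\}$, where $2\le m_1\le m_2$. Let $s$ and $i$ be integers with $\max\{1,s-m_2\}\le i\le \min\{m_1,s-1\}$, and let $S_i=\{x_1,\dots,x_i,y_1,\dots,y_{s-i}\}$. If $s\le m_2-m_1+2$, then $\kappa^*_{K_{m_1,m_2}}(S_i)=m_1$.
   Context: For $S\subseteq V(G)$ with $|S|\ge 2$, an $S$-Steiner tree of $G$ is a subtree $T$ of $G$ with $S\subseteq V(T)$ all of whose leaves belong to $S$. A family of $S$-Steiner trees $T_1,\dots,T_k$ is completely independent if for all $1\le p<q\le k$: $E(T_p)\cap E(T_q)=\emptyset$, $V(T_p)\cap V(T_q)=S$, and for any two vertices $x_1,x_2\in S$ the $(x_1,x_2)$-paths in $T_p$ and in $T_q$ are internally disjoint. $\kappa^*_G(S)$ is the maximum number of trees in a completely independent family of $S$-Steiner trees in $G$. -}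

module Defs where

open import Data.Empty using (⊥)
open import Data.Fin.Base as Fin using (Fin; toℕ)
open import Data.List.Base using (List; []; _∷_; length)
open import Data.List.Membership.Propositional using () renaming (_∈_ to _∈ˡ_)
open import Data.List.Relation.Unary.Unique.Propositional using (Unique)
open import Data.Nat.Base using (ℕ; _≤_; _<_; _∸_)
open import Data.Product using (Σ; ∃; ∃₂; ∃!; _×_; _,_; proj₁)
open import Data.Sum.Base using (_⊎_; inj₁; inj₂)
open import Data.Unit.Base using (⊤; tt)
open import Level using (0ℓ)
open import Relation.Binary.Core using (Rel)
open import Relation.Binary.Definitions using (Symmetric; Irreflexive)
open import Relation.Binary.Construct.Closure.ReflexiveTransitive using (Star; ε; _◅_)
open import Relation.Binary.PropositionalEquality using (_≡_; _≢_)
open import Relation.Nullary using (¬_)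
open import Relation.Unary using (Pred; _∈_; _⊆_; _∩_; _≐_; Satisfiable)

record SimpleGraph : Set₁ where
  field
    Vertex     : Set
    Adj        : Rel Vertex 0ℓ
    adj-sym    : Symmetric Adj
    adj-irrefl : Irreflexive _≡_ Adj

open SimpleGraph public

-- Edges are unordered: {u , v} is an edge iff E u v, equivalently E v u.
record Subgraph (G : SimpleGraph) : Set₁ where
  field
    V     : Pred (Vertex G) 0ℓ
    E     : Rel (Vertex G) 0ℓ
    E-sym : Symmetric E
    E⇒Adj : ∀ {u v} → E u v → Adj G u v
    E⇒V   : ∀ {u v} → E u v → u ∈ V

open Subgraph public

vertices : {A : Set} {R : Rel A 0ℓ} {u v : A} → Star R u v → List A
vertices {u = u} ε       = u ∷ []
vertices {u = u} (_ ◅ w) = u ∷ vertices w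

module _ {G : SimpleGraph} where

  -- A trivial path at u exists even when u is not a vertex of T;
  -- below, paths are only considered between vertices of T.
  Path : Subgraph G → Vertex G → Vertex G → Set
  Path T u v = Σ (Star (E T) u v) λ w → Unique (vertices w)

  pathVertices : ∀ {T u v} → Path T u v → List (Vertex G)
  pathVertices P = vertices (proj₁ P)

  InternallyDisjoint : ∀ {T T′ u v} → Path T u v → Path T′ u v → Set
  InternallyDisjoint {T} {T′} {u} {v} P Q =
    ∀ {z} → z ∈ˡ pathVertices {T} P → z ∈ˡ pathVertices {T′} Q → z ≡ u ⊎ z ≡ v

  -- A path on at least three vertices together with an edge joining its ends.
  Cycle : Subgraph G → Set
  Cycle T = ∃₂ λ u v → Σ (Path T u v) λ P → 3 ≤ length (pathVertices {T} P) × E T v u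

  record IsTree (T : Subgraph G) : Set where
    field
      nonempty  : Satisfiable (V T)
      connected : ∀ {u v} → u ∈ V T → v ∈ V T → Path T u v
      acyclic   : ¬ Cycle T

  Leaf : Subgraph G → Pred (Vertex G) 0ℓ
  Leaf T v = v ∈ V T × ∃! _≡_ (E T v)

  AtLeastTwo : Pred (Vertex G) 0ℓ → Set
  AtLeastTwo S = ∃₂ λ u v → u ∈ S × v ∈ S × u ≢ v

  record IsSteinerTree (S : Pred (Vertex G) 0ℓ) (T : Subgraph G) : Set where
    field
      |S|≥2    : AtLeastTwo S
      isTree   : IsTree T
      S⊆V      : S ⊆ V T
      leaves⊆S : Leaf T ⊆ S

  -- In a tree the (x₁ , x₂)-path is unique, so quantifying over all of them
  -- speaks about that one path.
  record CompletelyIndependent₂ (S : Pred (Vertex G) 0ℓ) (T T′ : Subgraph G) : Set where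
    field
      E∩E′≡∅  : ∀ {u v} → ¬ (E T u v × E T′ u v)
      V∩V′≐S  : (V T ∩ V T′) ≐ S
      paths   : ∀ {x₁ x₂} → x₁ ∈ S → x₂ ∈ S → x₁ ≢ x₂ →
                (P : Path T x₁ x₂) (Q : Path T′ x₁ x₂) →
                InternallyDisjoint {T} {T′} P Q

  record CompletelyIndependentFamily (S : Pred (Vertex G) 0ℓ) {k : ℕ}
                                     (T : Fin k → Subgraph G) : Set where
    field
      steiner     : ∀ p → IsSteinerTree S (T p)
      independent : ∀ {p q} → p Fin.< q → CompletelyIndependent₂ S (T p) (T q)

-- Isκ* G S k says that κ*_G(S) = k: some family has k members, and none has more.
record Isκ* (G : SimpleGraph) (S : Pred (Vertex G) 0ℓ) (k : ℕ) : Set₁ where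
  field
    attained : ∃ λ (T : Fin k → Subgraph G) → CompletelyIndependentFamily S T
    maximal  : ∀ {l} (T : Fin l → Subgraph G) → CompletelyIndependentFamily S T → l ≤ k

-- x_{j+1} is inj₁ j and y_{j+1} is inj₂ j, with j counted from 0.
K : ℕ → ℕ → SimpleGraph
K m₁ m₂ = record
  { Vertex     = Fin m₁ ⊎ Fin m₂
  ; Adj        = adj
  ; adj-sym    = λ {u} {v} → sym′ u v
  ; adj-irrefl = λ {u} {v} → irr u v
  }
  where
  adj : Rel (Fin m₁ ⊎ Fin m₂) 0ℓ
  adj (inj₁ _) (inj₂ _) = ⊤
  adj (inj₂ _) (inj₁ _) = ⊤
  adj (inj₁ _) (inj₁ _) = ⊥
  adj (inj₂ _) (inj₂ _) = ⊥

  sym′ : ∀ u v → adj u v → adj v u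
  sym′ (inj₁ _) (inj₂ _) _ = tt
  sym′ (inj₂ _) (inj₁ _) _ = tt

  irr : ∀ u v → u ≡ v → ¬ adj u v
  irr (inj₁ _) (inj₁ _) _ ()
  irr (inj₂ _) (inj₂ _) _ ()
  irr (inj₁ _) (inj₂ _) ()
  irr (inj₂ _) (inj₁ _) ()

-- {x₁,…,xᵢ , y₁,…,y_{s-i}}
Sᵢ : (m₁ m₂ s i : ℕ) → Pred (Vertex (K m₁ m₂)) 0ℓ
Sᵢ m₁ m₂ s i (inj₁ j) = toℕ j < i
Sᵢ m₁ m₂ s i (inj₂ j) = toℕ j < s ∸ i

{-# OPTIONS --safe #-}
-- Upper bound: every tree contains an edge at y₁, these edges are distinct, and y₁ has degree m₁.
--
-- Lower bound: for each x_p take the double star with adjacent hubs x_p and some y_{w(p)}, in which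
-- x_p is joined to all y ∈ S and y_{w(p)} to all x ∈ S.  An inner vertex of a path is a hub, so
-- distinct hubs make the family completely independent.  For i ≥ 2 there is room to take all
-- y_{w(p)} outside S.  For i = 1 one such vertex may be missing; the tree at x₁ is then the plain
-- star, which is the double star whose second hub is the last y of S.
module Submission where

open import Data.Empty using (⊥; ⊥-elim)
open import Data.Fin.Base as Fin using (Fin; zero; suc; toℕ; fromℕ<)
import Data.Fin.Properties as Fin
open import Data.List.Membership.Propositional using () renaming (_∈_ to _∈ˡ_)
open import Data.List.Relation.Unary.All as All using ([]; _∷_)
open import Data.List.Relation.Unary.AllPairs using ([]; _∷_)
open import Data.List.Relation.Unary.Any using (here; there)
open import Data.Nat.Base using (ℕ; zero; suc; _≤_; _<_; _+_; _∸_; _⊔_; _⊓_; z≤n; s≤s)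
open import Data.Nat.Properties
open import Data.Product using (∃; ∃₂; _×_; _,_; proj₁; proj₂)
open import Data.Sum.Base using (_⊎_; inj₁; inj₂; swap)
open import Data.Sum.Properties using (inj₁-injective; inj₂-injective)
open import Function.Base using (_∘_)
open import Level using (0ℓ)
open import Relation.Binary.Core using (Rel)
open import Relation.Binary.Construct.Closure.ReflexiveTransitive using (Star; ε; _◅_)
open import Relation.Binary.Definitions using (tri<; tri≈; tri>)
open import Relation.Binary.PropositionalEquality
  using (_≡_; _≢_; refl; sym; trans; cong; subst; ≢-sym)
open import Relation.Nullary using (¬_; yes; no)
open import Relation.Unary using (Pred; _∈_; _∉_)
open import Defs

-- Branching vertices on paths and cycles

Branching : {A : Set} → Rel A 0ℓ → Pred A 0ℓ
Branching R z = ∃₂ λ a b → R z a × R z b × a ≢ b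

module _ {G : SimpleGraph} (T : Subgraph G) where

  start∈vertices : ∀ {u v} (w : Star (E T) u v) → u ∈ˡ vertices w
  start∈vertices ε       = here refl
  start∈vertices (_ ◅ _) = here refl

  -- The predecessor and the successor of an inner vertex are both its neighbours, and they differ
  -- because a path repeats no vertex.
  inner-branching : ∀ {u v z} (P : Path T u v) → z ∈ˡ pathVertices {T = T} P →
    (z ≡ u ⊎ z ≡ v) ⊎ Branching (E T) z
  inner-branching (ε , _) (here z≡u) = inj₁ (inj₁ z≡u)
  inner-branching (_ ◅ _ , _) (here z≡u) = inj₁ (inj₁ z≡u)
  inner-branching (_ ◅ ε , _) (there (here z≡v)) = inj₁ (inj₂ z≡v)
  inner-branching (e ◅ f ◅ w , (_ ∷ u∉) ∷ uniq) (there z∈)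
    with inner-branching (f ◅ w , uniq) z∈
  ... | inj₁ (inj₁ refl) =
        inj₂ (_ , _ , E-sym T e , f , All.lookup u∉ (start∈vertices w))
  ... | inj₁ (inj₂ z≡v) = inj₁ (inj₂ z≡v)
  ... | inj₂ branching  = inj₂ branching

  -- Each vertex of a cycle has two distinct neighbours on it; three such vertices suffice to
  -- contradict a bound of two hubs.
  cycle-branching : Cycle T → ∃ λ a → ∃₂ λ b c →
    (a ≢ b × a ≢ c × b ≢ c) ×
    Branching (E T) a × Branching (E T) b × Branching (E T) c
  cycle-branching (_ , _ , (ε , _) , s≤s () , _)
  cycle-branching (_ , _ , (_ ◅ ε , _) , s≤s (s≤s ()) , _)
  -- In a triangle the closing edge `g` gives the third vertex its second neighbour; on longer
  -- cycles this is the edge `h` to the fourth vertex.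
  cycle-branching (u , v , (e ◅ f ◅ ε , (u≢b ∷ u≢c ∷ []) ∷ (b≢c ∷ []) ∷ _) , _ , g) =
    _ , _ , _ , (u≢b , u≢c , b≢c) ,
    (_ , _ , e , E-sym T g , b≢c) ,
    (_ , _ , E-sym T e , f , u≢c) ,
    (_ , _ , E-sym T f , g , ≢-sym u≢b)
  cycle-branching (u , v , (e ◅ f ◅ h ◅ w , (u≢b ∷ u≢c ∷ u∉) ∷ (b≢c ∷ b∉) ∷ _) , _ , g) =
    _ , _ , _ , (u≢b , u≢c , b≢c) ,
    (_ , _ , e , E-sym T g , All.lookup b∉ (end∈vertices w)) ,
    (_ , _ , E-sym T e , f , u≢c) ,
    (_ , _ , E-sym T f , h , All.lookup b∉ (start∈vertices w))
    where
    end∈vertices : ∀ {u v} (w : Star (E T) u v) → v ∈ˡ vertices w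
    end∈vertices ε       = here refl
    end∈vertices (_ ◅ w) = there (end∈vertices w)

-- Double stars as Steiner trees

module DoubleStar {m₁ m₂ : ℕ} (S : Pred (Vertex (K m₁ m₂)) 0ℓ) where

  Hub : Fin m₁ → Fin m₂ → Pred (Vertex (K m₁ m₂)) 0ℓ
  Hub p w v = v ≡ inj₁ p ⊎ v ≡ inj₂ w

  -- All edges on `V′` that meet a hub are taken. By bipartiteness these form a star at each hub,
  -- and the two stars share the edge between the hubs.
  doubleStar : Fin m₁ → Fin m₂ → Subgraph (K m₁ m₂)
  doubleStar p w = record
    { V     = V′
    ; E     = λ u v → Adj (K m₁ m₂) u v × V′ u × V′ v × (Hub p w u ⊎ Hub p w v)
    ; E-sym = λ {u} {v} (uv , u∈V , v∈V , h) →
                adj-sym (K m₁ m₂) {u} {v} uv , v∈V , u∈V , swap h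
    ; E⇒Adj = proj₁
    ; E⇒V   = proj₁ ∘ proj₂
    }
    where
    V′ : Pred (Vertex (K m₁ m₂)) 0ℓ
    V′ v = v ∈ S ⊎ Hub p w v

  -- In the second case the hub w adds nothing, and the double star is a star.
  Admissible : Fin m₁ → Fin m₂ → Set
  Admissible p w =
    (inj₂ w ∉ S × ∃ λ x → inj₁ x ∈ S × x ≢ p) ⊎
    (inj₂ w ∈ S × ∀ x → inj₁ x ∈ S → x ≡ p)

  module _ (p : Fin m₁) (w : Fin m₂) where

    private
      T = doubleStar p w

    hubs-same-side : ∀ u {v v′} → Adj (K m₁ m₂) u v → Adj (K m₁ m₂) u v′ →
      Hub p w v → Hub p w v′ → v ≡ v′
    hubs-same-side _        _ _ (inj₁ refl) (inj₁ refl) = refl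
    hubs-same-side _        _ _ (inj₂ refl) (inj₂ refl) = refl
    hubs-same-side (inj₁ _) () _ (inj₁ refl) (inj₂ refl)
    hubs-same-side (inj₂ _) _ () (inj₁ refl) (inj₂ refl)
    hubs-same-side (inj₁ _) _ () (inj₂ refl) (inj₁ refl)
    hubs-same-side (inj₂ _) () _ (inj₂ refl) (inj₁ refl)

    -- Every edge has a hub end, so the neighbours of a non-hub are hubs on the opposite side, where
    -- there is only one.
    branching⇒hub : ∀ {z} → Branching (E T) z → Hub p w z
    branching⇒hub (_ , _ , (_ , _ , _ , inj₁ h) , _) = h
    branching⇒hub (_ , _ , _ , (_ , _ , _ , inj₁ h) , _) = h
    branching⇒hub {z} (_ , _ , (za , _ , _ , inj₂ h) , (zb , _ , _ , inj₂ h′) , a≢b) =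
      ⊥-elim (a≢b (hubs-same-side z za zb h h′))

    no-three-hubs : ∀ {a b c} → a ≢ b × a ≢ c × b ≢ c → Hub p w a → Hub p w b → ¬ Hub p w c
    no-three-hubs (a≢b , _ , _) (inj₁ refl) (inj₁ refl) _ = a≢b refl
    no-three-hubs (a≢b , _ , _) (inj₂ refl) (inj₂ refl) _ = a≢b refl
    no-three-hubs (_ , a≢c , _) (inj₁ refl) _ (inj₁ refl) = a≢c refl
    no-three-hubs (_ , a≢c , _) (inj₂ refl) _ (inj₂ refl) = a≢c refl
    no-three-hubs (_ , _ , b≢c) _ (inj₁ refl) (inj₁ refl) = b≢c refl
    no-three-hubs (_ , _ , b≢c) _ (inj₂ refl) (inj₂ refl) = b≢c refl

    xHub∈V : inj₁ p ∈ V T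
    xHub∈V = inj₂ (inj₁ refl)

    yHub∈V : inj₂ w ∈ V T
    yHub∈V = inj₂ (inj₂ refl)

    xHub—y : ∀ {y} → inj₂ y ∈ V T → E T (inj₁ p) (inj₂ y)
    xHub—y y∈V = _ , xHub∈V , y∈V , inj₁ (inj₁ refl)

    yHub—x : ∀ {x} → inj₁ x ∈ V T → E T (inj₂ w) (inj₁ x)
    yHub—x x∈V = _ , yHub∈V , x∈V , inj₁ (inj₂ refl)

    y—xHub : ∀ {y} → inj₂ y ∈ V T → E T (inj₂ y) (inj₁ p)
    y—xHub {y} = E-sym T {inj₁ p} {inj₂ y} ∘ xHub—y

    x—yHub : ∀ {x} → inj₁ x ∈ V T → E T (inj₁ x) (inj₂ w)
    x—yHub {x} = E-sym T {inj₂ w} {inj₁ x} ∘ yHub—x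

    connected : ∀ {u v} → u ∈ V T → v ∈ V T → Path T u v
    connected {inj₁ x} {inj₁ x′} x∈V x′∈V with x Fin.≟ x′
    ... | yes refl = ε , [] ∷ []
    ... | no x≢x′  = x—yHub x∈V ◅ yHub—x x′∈V ◅ ε ,
          ((λ ()) ∷ x≢x′ ∘ inj₁-injective ∷ []) ∷ ((λ ()) ∷ []) ∷ [] ∷ []
    connected {inj₂ y} {inj₂ y′} y∈V y′∈V with y Fin.≟ y′
    ... | yes refl = ε , [] ∷ []
    ... | no y≢y′  = y—xHub y∈V ◅ xHub—y y′∈V ◅ ε ,
          ((λ ()) ∷ y≢y′ ∘ inj₂-injective ∷ []) ∷ ((λ ()) ∷ []) ∷ [] ∷ []
    connected {inj₁ x} {inj₂ y} x∈V y∈V with x Fin.≟ p | y Fin.≟ w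
    ... | yes refl | _        = xHub—y y∈V ◅ ε , ((λ ()) ∷ []) ∷ [] ∷ []
    ... | no _     | yes refl = x—yHub x∈V ◅ ε , ((λ ()) ∷ []) ∷ [] ∷ []
    -- Neither end is a hub, so the path crosses the edge between the hubs.
    ... | no x≢p   | no y≢w   = x—yHub x∈V ◅ yHub—x xHub∈V ◅ xHub—y y∈V ◅ ε ,
          ((λ ()) ∷ x≢p ∘ inj₁-injective ∷ (λ ()) ∷ []) ∷
          ((λ ()) ∷ ≢-sym y≢w ∘ inj₂-injective ∷ []) ∷ ((λ ()) ∷ []) ∷ [] ∷ []
    connected {inj₂ y} {inj₁ x} y∈V x∈V with x Fin.≟ p | y Fin.≟ w
    ... | yes refl | _        = y—xHub y∈V ◅ ε , ((λ ()) ∷ []) ∷ [] ∷ []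
    ... | no _     | yes refl = yHub—x x∈V ◅ ε , ((λ ()) ∷ []) ∷ [] ∷ []
    ... | no x≢p   | no y≢w   = y—xHub y∈V ◅ xHub—y yHub∈V ◅ yHub—x x∈V ◅ ε ,
          ((λ ()) ∷ y≢w ∘ inj₂-injective ∷ (λ ()) ∷ []) ∷
          ((λ ()) ∷ ≢-sym x≢p ∘ inj₁-injective ∷ []) ∷ ((λ ()) ∷ []) ∷ [] ∷ []

    isTree : IsTree T
    isTree = record
      { nonempty  = inj₁ p , xHub∈V
      ; connected = connected
      ; acyclic   = λ C → let _ , _ , _ , distinct , a , b , c = cycle-branching T C in
          no-three-hubs distinct (branching⇒hub a) (branching⇒hub b) (branching⇒hub c)
      }

    branching⇒¬leaf : ∀ {z} → Branching (E T) z → ¬ Leaf T z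
    branching⇒¬leaf (_ , _ , za , zb , a≢b) (_ , _ , _ , only) =
      a≢b (trans (sym (only za)) (only zb))

    -- Only hubs can lie outside `S`. In the first case of `Admissible` each hub has a neighbour in
    -- `S` besides the other hub, so it is no leaf; in the second case both hubs are in `S`.
    leaf∈S : Admissible p w → ∃ (λ x → inj₁ x ∈ S) → ∃ (λ y → inj₂ y ∈ S) →
      ∀ {v} → Leaf T v → v ∈ S
    leaf∈S _ _ _ (inj₁ v∈S , _) = v∈S
    leaf∈S (inj₁ (w∉S , _)) _ (y , y∈S) leaf@(inj₂ (inj₁ refl) , _) =
      ⊥-elim (branching⇒¬leaf
        (_ , _ , xHub—y (inj₁ y∈S) , xHub—y yHub∈V , λ { refl → w∉S y∈S }) leaf)
    leaf∈S (inj₂ (_ , only-p)) (x , x∈S) _ (inj₂ (inj₁ refl) , _) =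
      subst (λ x → inj₁ x ∈ S) (only-p x x∈S) x∈S
    leaf∈S (inj₁ (_ , x , x∈S , x≢p)) _ _ leaf@(inj₂ (inj₂ refl) , _) =
      ⊥-elim (branching⇒¬leaf
        (_ , _ , yHub—x (inj₁ x∈S) , yHub—x xHub∈V , x≢p ∘ inj₁-injective) leaf)
    leaf∈S (inj₂ (w∈S , _)) _ _ (inj₂ (inj₂ refl) , _) = w∈S

  -- Independence of two double stars

  module _ {p q : Fin m₁} {w w′ : Fin m₂} (p≢q : p ≢ q) (w≢w′ : w ≢ w′) where

    no-common-hub : ∀ {v} → Hub p w v → ¬ Hub q w′ v
    no-common-hub (inj₁ refl) (inj₁ refl) = p≢q refl
    no-common-hub (inj₂ refl) (inj₂ refl) = w≢w′ refl

    common-vertex∈S : ∀ {v} → v ∈ V (doubleStar p w) → v ∈ V (doubleStar q w′) → v ∈ S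
    common-vertex∈S (inj₁ v∈S) _          = v∈S
    common-vertex∈S (inj₂ _)   (inj₁ v∈S) = v∈S
    common-vertex∈S (inj₂ h)   (inj₂ h′)  = ⊥-elim (no-common-hub h h′)

    -- Such an edge would join the X-hub of one tree to the Y-hub of the other inside `S`. The tree
    -- owning the Y-hub forbids this: either its Y-hub is outside `S`, or its X-hub is the only
    -- vertex of X in `S`.
    mixed-hubs-not-in-S : Admissible p w → Admissible q w′ →
      ∀ {u v} → Adj (K m₁ m₂) u v → u ∈ S → v ∈ S → Hub p w u → ¬ Hub q w′ v
    mixed-hubs-not-in-S _ _ () _ _ (inj₁ refl) (inj₁ refl)
    mixed-hubs-not-in-S _ _ () _ _ (inj₂ refl) (inj₂ refl)
    mixed-hubs-not-in-S _ (inj₁ (w′∉S , _)) _ _ w′∈S (inj₁ refl) (inj₂ refl) = w′∉S w′∈S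
    mixed-hubs-not-in-S _ (inj₂ (_ , only-q)) _ p∈S _ (inj₁ refl) (inj₂ refl) =
      p≢q (only-q p p∈S)
    mixed-hubs-not-in-S (inj₁ (w∉S , _)) _ _ w∈S _ (inj₂ refl) (inj₁ refl) = w∉S w∈S
    mixed-hubs-not-in-S (inj₂ (_ , only-p)) _ _ _ q∈S (inj₂ refl) (inj₁ refl) =
      p≢q (sym (only-p q q∈S))

    -- A common edge has both ends in `S` and a hub of each tree among them. No vertex is a hub of
    -- both trees, so the two hubs are its opposite ends.
    edge-disjoint : Admissible p w → Admissible q w′ →
      ∀ {u v} → ¬ (E (doubleStar p w) u v × E (doubleStar q w′) u v)
    edge-disjoint adm adm′ {u} {v} ((uv , u∈V , v∈V , h) , (_ , u∈V′ , v∈V′ , h′)) =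
      cases h h′
      where
      u∈S : u ∈ S
      u∈S = common-vertex∈S u∈V u∈V′

      v∈S : v ∈ S
      v∈S = common-vertex∈S v∈V v∈V′

      cases : Hub p w u ⊎ Hub p w v → Hub q w′ u ⊎ Hub q w′ v → ⊥
      cases (inj₁ hu) (inj₁ hu′) = no-common-hub hu hu′
      cases (inj₂ hv) (inj₂ hv′) = no-common-hub hv hv′
      cases (inj₁ hu) (inj₂ hv′) = mixed-hubs-not-in-S adm adm′ uv u∈S v∈S hu hv′
      cases (inj₂ hv) (inj₁ hu′) =
        mixed-hubs-not-in-S adm adm′ (adj-sym (K m₁ m₂) {u} {v} uv) v∈S u∈S hv hu′

    paths-disjoint : ∀ {u v} (P : Path (doubleStar p w) u v) (Q : Path (doubleStar q w′) u v) →
      InternallyDisjoint {T = doubleStar p w} {doubleStar q w′} P Q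
    paths-disjoint P Q z∈P z∈Q
      with inner-branching (doubleStar p w) P z∈P | inner-branching (doubleStar q w′) Q z∈Q
    ... | inj₁ z-end | _          = z-end
    ... | inj₂ _     | inj₁ z-end = z-end
    ... | inj₂ b     | inj₂ b′    =
          ⊥-elim (no-common-hub (branching⇒hub p w b) (branching⇒hub q w′ b′))

    independent₂ : Admissible p w → Admissible q w′ →
      CompletelyIndependent₂ S (doubleStar p w) (doubleStar q w′)
    independent₂ adm adm′ = record
      { E∩E′≡∅ = edge-disjoint adm adm′
      ; V∩V′≐S = (λ (v∈V , v∈V′) → common-vertex∈S v∈V v∈V′) , λ v∈S → inj₁ v∈S , inj₁ v∈S
      ; paths  = λ _ _ _ → paths-disjoint
      }

  independentFamily : (w : Fin m₁ → Fin m₂) → (∀ {p q} → w p ≡ w q → p ≡ q) →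
    (∀ p → Admissible p (w p)) → ∃ (λ x → inj₁ x ∈ S) → ∃ (λ y → inj₂ y ∈ S) →
    CompletelyIndependentFamily S (λ p → doubleStar p (w p))
  independentFamily w w-injective adm (x , x∈S) (y , y∈S) = record
    { steiner = λ p → record
        { |S|≥2    = inj₁ x , inj₂ y , x∈S , y∈S , λ ()
        ; isTree   = isTree p (w p)
        ; S⊆V      = inj₁
        ; leaves⊆S = leaf∈S p (w p) (adm p) (x , x∈S) (y , y∈S)
        }
    ; independent = λ p<q →
        independent₂ (Fin.<⇒≢ p<q) (Fin.<⇒≢ p<q ∘ w-injective) (adm _) (adm _)
    }

-- Upper bound from the edges at a vertex of Y

module _ {m₁ m₂ : ℕ} where

  -- The ends are on different sides, so the walk has a first edge, and bipartiteness sends it into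
  -- X.
  y-neighbour : {T : Subgraph (K m₁ m₂)} {x : Fin m₁} {y : Fin m₂} →
    Star (E T) (inj₂ y) (inj₁ x) → ∃ λ x′ → E T (inj₂ y) (inj₁ x′)
  y-neighbour     (_◅_ {j = inj₁ x′} e _) = x′ , e
  y-neighbour {T} (_◅_ {j = inj₂ _}  e _) = ⊥-elim (E⇒Adj T e)

  familySize≤m₁ : ∀ {S : Pred (Vertex (K m₁ m₂)) 0ℓ} {x y} → inj₁ x ∈ S → inj₂ y ∈ S →
    ∀ {l} (T : Fin l → Subgraph (K m₁ m₂)) → CompletelyIndependentFamily S T → l ≤ m₁
  familySize≤m₁ {x = x} {y} x∈S y∈S {l} T F = Fin.injective⇒≤ {f = f} f-injective
    where
    open CompletelyIndependentFamily F

    edge : ∀ p → ∃ λ x′ → E (T p) (inj₂ y) (inj₁ x′)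
    edge p = y-neighbour {T = T p} (proj₁ (IsTree.connected isTree (S⊆V y∈S) (S⊆V x∈S)))
      where open IsSteinerTree (steiner p)

    f : Fin l → Fin m₁
    f p = proj₁ (edge p)

    f-distinct : ∀ {p q} → p Fin.< q → f p ≢ f q
    -- Equal values of `f` would make the two trees share an edge at `y`.
    f-distinct {p} {q} p<q fp≡fq = CompletelyIndependent₂.E∩E′≡∅ (independent p<q)
      ( subst (λ x → E (T p) (inj₂ y) (inj₁ x)) fp≡fq (proj₂ (edge p))
      , proj₂ (edge q))

    f-injective : ∀ {p q} → f p ≡ f q → p ≡ q
    f-injective {p} {q} fp≡fq with Fin.<-cmp p q
    ... | tri< p<q _ _ = ⊥-elim (f-distinct p<q fp≡fq)
    ... | tri≈ _ p≡q _ = p≡q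
    ... | tri> _ _ q<p = ⊥-elim (f-distinct q<p (sym fp≡fq))

-- Choice of the hubs in Y

module _ {m₁ m₂ r : ℕ} (m₁≤m₂ : m₁ ≤ m₂) (r≤m₂∸m₁ : r ≤ m₂ ∸ m₁) where

  shift<m₂ : (p : Fin m₁) → r + toℕ p < m₂
  shift<m₂ p = subst (r + toℕ p <_) (m∸n+n≡m m₁≤m₂) (+-mono-≤-< r≤m₂∸m₁ (Fin.toℕ<n p))

  -- The hubs are `m₁` consecutive vertices of Y from index `r` on; they fit because `r + m₁ ≤ m₂`.
  shift : Fin m₁ → Fin m₂
  shift p = fromℕ< (shift<m₂ p)

  toℕ-shift : ∀ p → toℕ (shift p) ≡ r + toℕ p
  toℕ-shift p = Fin.toℕ-fromℕ< (shift<m₂ p)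

  shift-injective : ∀ {p q} → shift p ≡ shift q → p ≡ q
  shift-injective {p} {q} eq = Fin.toℕ-injective (+-cancelˡ-≡ r _ _
    (trans (sym (toℕ-shift p)) (trans (cong toℕ eq) (toℕ-shift q))))

-- Truncated subtraction would admit `m = n = 0`, which `1 ≤ m` excludes.
≤∸1⇒< : ∀ {m n} → 1 ≤ m → m ≤ n ∸ 1 → m < n
≤∸1⇒< {n = zero}  () z≤n
≤∸1⇒< {n = suc _} _   m≤n = s≤s m≤n

theorem3p5 : (m₁ m₂ s i : ℕ) → 2 ≤ m₁ → m₁ ≤ m₂ →
    1 ⊔ (s ∸ m₂) ≤ i → i ≤ m₁ ⊓ (s ∸ 1) →
    s ≤ (m₂ ∸ m₁) + 2 →
    Isκ* (K m₁ m₂) (Sᵢ m₁ m₂ s i) m₁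
theorem3p5 m₁@(suc (suc _)) m₂@(suc _) s i (s≤s (s≤s _)) m₁≤m₂ lower upper s≤ = record
  { attained = attained i i≥1 i<s
  -- Index `zero` stands for x₁ and for y₁; both are in the set because `1 ≤ i < s`.
  ; maximal  = familySize≤m₁ {x = zero} {y = zero} i≥1 (m<n⇒0<n∸m i<s)
  }
  where
  i≥1 : 1 ≤ i
  i≥1 = m⊔n≤o⇒m≤o 1 (s ∸ m₂) lower

  i<s : i < s
  i<s = ≤∸1⇒< i≥1 (m≤n⊓o⇒m≤o m₁ (s ∸ 1) upper)

  s∸2≤ : s ∸ 2 ≤ m₂ ∸ m₁
  s∸2≤ = m≤n+o⇒m∸n≤o s 2 (subst (s ≤_) (+-comm _ 2) s≤)

  attained : ∀ i → 1 ≤ i → i < s →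
    ∃ λ (T : Fin m₁ → Subgraph (K m₁ m₂)) →
      CompletelyIndependentFamily (Sᵢ m₁ m₂ s i) T
  -- Here `s ∸ 1` may exceed `m₂ ∸ m₁` by one, so the hubs start at `s ∸ 2`, the index of the last y
  -- in the set.
  attained 1 _ 1<s = _ ,
    independentFamily (shift m₁≤m₂ s∸2≤) (shift-injective m₁≤m₂ s∸2≤) admissible
      (zero , s≤s z≤n) (zero , m<n⇒0<n∸m 1<s)
    where
    open DoubleStar (Sᵢ m₁ m₂ s 1)

    s∸1≡ : s ∸ 1 ≡ suc (s ∸ 2)
    s∸1≡ = +-∸-assoc 1 1<s

    admissible : ∀ p → Admissible p (shift m₁≤m₂ s∸2≤ p)
    admissible zero = inj₂
      ( ≤-reflexive (trans (cong suc (trans (toℕ-shift m₁≤m₂ s∸2≤ zero) (+-identityʳ _))) (sym s∸1≡))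
      , λ { zero _ → refl ; (suc _) (s≤s ()) })
    -- Every later hub has index at least `s ∸ 1`, hence is outside the set, and x₁ differs from
    -- `p`.
    admissible p@(suc p′) = inj₁ (≤⇒≯ s∸1≤w , zero , s≤s z≤n , λ ())
      where
      open ≤-Reasoning
      s∸1≤w : s ∸ 1 ≤ toℕ (shift m₁≤m₂ s∸2≤ p)
      s∸1≤w = begin
        s ∸ 1                       ≡⟨ s∸1≡ ⟩
        suc (s ∸ 2)                 ≤⟨ s≤s (m≤m+n _ _) ⟩
        suc (s ∸ 2 + toℕ p′)        ≡⟨ +-suc _ _ ⟨
        s ∸ 2 + toℕ p               ≡⟨ toℕ-shift m₁≤m₂ s∸2≤ p ⟨
        toℕ (shift m₁≤m₂ s∸2≤ p)    ∎
  -- As `i ≥ 2`, `s ∸ i ≤ s ∸ 2 ≤ m₂ ∸ m₁`, so the hubs can start right after the last y in the set.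
  attained i@(suc (suc i′)) _ i<s = _ ,
    independentFamily (shift m₁≤m₂ s∸i≤) (shift-injective m₁≤m₂ s∸i≤)
      (λ p → inj₁ (≤⇒≯ (s∸i≤w p) , other p))
      (zero , s≤s z≤n) (zero , m<n⇒0<n∸m i<s)
    where
    open DoubleStar (Sᵢ m₁ m₂ s i)

    s∸i≤ : s ∸ i ≤ m₂ ∸ m₁
    s∸i≤ = ≤-trans (∸-monoʳ-≤ s (s≤s (s≤s z≤n))) s∸2≤

    s∸i≤w : ∀ p → s ∸ i ≤ toℕ (shift m₁≤m₂ s∸i≤ p)
    s∸i≤w p = subst (s ∸ i ≤_) (sym (toℕ-shift m₁≤m₂ s∸i≤ p)) (m≤m+n _ _)

    -- Both x₁ and x₂ are in the set, and one of them is not `p`.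
    other : ∀ p → ∃ λ (x : Fin m₁) → toℕ x < i × x ≢ p
    other zero    = suc zero , s≤s (s≤s z≤n) , λ ()
    other (suc _) = zero , s≤s z≤n , λ ()
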